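{- Let $\Delta$ be a pure $d$-dimensional simplicial complex that is acyclic in positive codimension (i.e. $\tilde H_j(\Delta;\mathbb{Q})=0$ for all $j<d$), and fix $i<d$. Let $\Upsilon$ be an $i$-dimensional spanning tree of $\Delta$ (i.e. a spanning tree of the $i$-skeleton $\Delta_{(i)}$), and let $\Theta=\Delta_i\setminus\Upsilon_i$ be the set of $i$-dimensional faces of $\Delta$ not in $\Upsilon$. Let $\tilde L$ be the reduced Laplacian, obtained from the matrix of $L_{\Delta,i}$ by deleting the rows and columns indexed by the $i$-faces of $\Upsilon$ (equivalently, restricting to the rows and columns indexed by $\Theta$). Suppose that $\tilde H_{i-1}(\Upsilon;\mathbb{Z})=0$. Then $$K_i(\Delta)\cong \mathbb{Z}^{\Theta}/\operatorname{im}\tilde L.$$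
   Context: For a finite simplicial complex $\Delta$, $\Delta_j$ denotes the set of $j$-dimensional faces, $\Delta_{(j)}$ the $j$-skeleton (all faces of dimension $\le j$), $C_j(\Delta;\mathbb{Z})$ the (augmented) simplicial chain group with basis the oriented $j$-faces (including $C_{ -1}$ generated by the empty face), $\partial_j:C_j\to C_{j-1}$ the simplicial boundary map, and $\partial^*_j:C_{j-1}\to C_j$ the coboundary map, identified with the transpose of $\partial_j$ via the standard inner product in which faces form an orthonormal basis. $\tilde H_j(\Delta;R)$ is reduced homology, $\beta_j(\Delta)=\dim_{\mathbb{Q}}\tilde H_j(\Delta;\mathbb{Q})$, and $f_j(\Delta)=|\Delta_j|$. The $i$-dimensional (up-down) combinatorial Laplacian is $L_{\Delta,i}=\partial_{i+1}\partial^*_{i+1}:C_i(\Delta;\mathbb{Z})\to C_i(\Delta;\mathbb{Z})$, and the $i$-dimensional critical group is $K_i(\Delta)=\ker\partial_i/\operatorname{im}(\partial_{i+1}\partial^*_{i+1})$. For a pure $k$-dimensional complex $\Gamma$, a (simplicial) spanning tree of $\Gamma$ is a subcomplex $\Upsilon\subseteq\Gamma$ with $\Upsilon_{(k-1)}=\Gamma_{(k-1)}$ such that (1) $\tilde H_k(\Upsilon;\mathbb{Z})=0$, (2) $\tilde H_{k-1}(\Upsilon;\mathbb{Q})=0$, and (3) $f_k(\Upsilon)=f_k(\Gamma)-\beta_k(\Gamma)+\beta_{k-1}(\Gamma)$. An $i$-dimensional spanning tree of $\Delta$ is a spanning tree of $\Delta_{(i)}$. -}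

module Defs where

open import Level using (Level; _⊔_; 0ℓ)
open import Data.Bool using (Bool; true; false; if_then_else_; T; _∧_; not)
open import Data.Nat using (ℕ; zero; suc; _≤_; _<_; _≤ᵇ_; _≡ᵇ_)
import Data.Nat as ℕ
open import Data.Fin using (Fin; zero; suc)
open import Data.Vec using (Vec; []; _∷_; lookup; _[_]≔_)
open import Data.List using (List; []; _∷_; _++_; map)
open import Data.Fin.Subset using (Subset; _⊆_; ∣_∣) renaming (⊥ to ∅)
open import Data.Product using (Σ; ∃; ∃₂; _×_; _,_; proj₁)
open import Relation.Binary.PropositionalEquality using (_≡_)
open import Relation.Nullary using (¬_)
open import Algebra.Bundles using (Ring)
import Data.Integer as ℤ
import Data.Integer.Properties as ℤP
import Data.Rational.Properties as ℚP

-- Finite abstract simplicial complexes on the vertex set Fin n.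
-- A face is a subset of Fin n; the face of size s has dimension s - 1.
-- The empty face (dimension -1) is always a face (augmented complex).

record Complex (n : ℕ) : Set where
  field
    face        : Subset n → Bool
    empty-face  : T (face ∅)
    down-closed : ∀ {σ τ} → σ ⊆ τ → T (face τ) → T (face σ)
open Complex public

IsPure : ∀ {n} → Complex n → ℕ → Set
IsPure Δ d =
  (∀ σ → T (face Δ σ) → ∣ σ ∣ ≤ suc d) ×
  (∀ σ → T (face Δ σ) → ∃ λ τ → T (face Δ τ) × σ ⊆ τ × ∣ τ ∣ ≡ suc d)

skel : ∀ {n} → Complex n → ℕ → Subset n → Bool
skel Δ i σ = face Δ σ ∧ (∣ σ ∣ ≤ᵇ suc i)

allSubsets : (n : ℕ) → List (Subset n)
allSubsets zero = [] ∷ []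
allSubsets (suc n) = map (true ∷_) (allSubsets n) ++ map (false ∷_) (allSubsets n)

countTrue : ∀ {n} → (Subset n → Bool) → List (Subset n) → ℕ
countTrue P [] = 0
countTrue P (σ ∷ σs) = (if P σ then 1 else 0) ℕ.+ countTrue P σs

fcount : ∀ {n} → (Subset n → Bool) → ℕ → ℕ
fcount {n} K s = countTrue (λ σ → K σ ∧ (∣ σ ∣ ≡ᵇ s)) (allSubsets n)

below : ∀ {n} → Subset n → Fin n → ℕ
below (b ∷ τ) zero = 0
below (b ∷ τ) (suc v) = (if b then 1 else 0) ℕ.+ below τ v

-- Chains with coefficients in a ring R (faces oriented by the vertex order).
-- A chain is a function from subsets to R; "InC K s x" says x lies in the
-- chain group spanned by the faces of K of size s.

module Chains {c ℓ} (R : Ring c ℓ) where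
  open Ring R using (_≈_; _+_; _*_; -_; _-_; 0#; 1#) renaming (Carrier to A)

  Chain : ℕ → Set c
  Chain n = Subset n → A

  sgn : ℕ → A
  sgn zero = 1#
  sgn (suc k) = - sgn k

  ∑ : ∀ {m} → (Fin m → A) → A
  ∑ {zero} f = 0#
  ∑ {suc m} f = f zero + ∑ (λ j → f (suc j))

  InC : ∀ {n} → (Subset n → Bool) → ℕ → Chain n → Set ℓ
  InC K s x = ∀ σ → ¬ (T (K σ) × ∣ σ ∣ ≡ s) → x σ ≈ 0#

  -- simplicial boundary: ∂[v₀…v_k] = Σ_j (-1)^j [v₀…v̂_j…v_k];
  -- coefficient of τ in ∂x is Σ_{v ∉ τ} (-1)^{#{u ∈ τ | u < v}} x(τ ∪ {v})
  ∂ : ∀ {n} → Chain n → Chain n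
  ∂ x τ = ∑ λ v → if lookup τ v then 0# else sgn (below τ v) * x (τ [ v ]≔ true)

  -- coboundary in the complex K (transpose of ∂ w.r.t. the faces of K)
  δ : ∀ {n} → (Subset n → Bool) → Chain n → Chain n
  δ K x σ = if K σ
    then ∑ (λ v → if lookup σ v then sgn (below σ v) * x (σ [ v ]≔ false) else 0#)
    else 0#

  IsCycle : ∀ {n} → (Subset n → Bool) → ℕ → Chain n → Set ℓ
  IsCycle K s x = InC K s x × (∀ τ → ∂ x τ ≈ 0#)

  IsBoundary : ∀ {n} → (Subset n → Bool) → ℕ → Chain n → Set (c ⊔ ℓ)
  IsBoundary K s x = ∃ λ y → InC K (suc s) y × (∀ σ → x σ ≈ ∂ y σ)

  -- reduced homology in dimension s - 1 vanishes
  Acyclic : ∀ {n} → (Subset n → Bool) → ℕ → Set (c ⊔ ℓ)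
  Acyclic K s = ∀ x → IsCycle K s x → IsBoundary K s x

  lin : ∀ {n r} → (Fin r → Chain n) → (Fin r → A) → Chain n
  lin z a σ = ∑ λ k → a k * z k σ

  -- the reduced homology in dimension s - 1 is free of rank r:
  -- there are r cycles whose classes form a basis of ker/im
  HasBetti : ∀ {n} → (Subset n → Bool) → ℕ → ℕ → Set (c ⊔ ℓ)
  HasBetti K s r = Σ (Fin r → Chain _) λ z →
    (∀ k → IsCycle K s (z k)) ×
    (∀ x → IsCycle K s x → ∃ λ a → IsBoundary K s (λ σ → x σ - lin z a σ)) ×
    (∀ a → IsBoundary K s (lin z a) → ∀ k → a k ≈ 0#)

module ℤC = Chains ℤP.+-*-ring
module ℚC = Chains ℚP.+-*-ring

-- β_j(Γ) over ℚ, indexed by face size s = j + 1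
Betti : ∀ {n} → (Subset n → Bool) → ℕ → ℕ → Set
Betti = ℚC.HasBetti

record IsSpanningTree {n} (Γ : Subset n → Bool) (k : ℕ) (Υ : Complex n) : Set where
  field
    subcomplex : ∀ σ → T (face Υ σ) → T (Γ σ)
    same-skel  : ∀ σ → ∣ σ ∣ ≤ k → T (Γ σ) → T (face Υ σ)
    top-acyclic : ℤC.Acyclic (face Υ) (suc k)
    low-acyclic : ℚC.Acyclic (face Υ) k
    face-count : ∃₂ λ b b' → Betti Γ (suc k) b × Betti Γ k b' ×
                   (fcount (face Υ) (suc k) ℕ.+ b ≡ fcount Γ (suc k) ℕ.+ b')

open ℤC using (Chain; InC; IsCycle; ∂; δ)

Lap : ∀ {n} → Complex n → Chain n → Chain n
Lap Δ x = ∂ (δ (face Δ) x)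

Θ : ∀ {n} → Complex n → Complex n → ℕ → Subset n → Bool
Θ Δ Υ i σ = face Δ σ ∧ not (face Υ σ) ∧ (∣ σ ∣ ≡ᵇ suc i)

redLap : ∀ {n} → Complex n → Complex n → ℕ → Chain n → Chain n
redLap Δ Υ i x σ = if Θ Δ Υ i σ then Lap Δ x σ else ℤ.0ℤ

-- K_i(Δ) = ker ∂_i / im L_{Δ,i}  :  numerator and denominator
K-num : ∀ {n} → Complex n → ℕ → Chain n → Set
K-num Δ i = IsCycle (face Δ) (suc i)

K-den : ∀ {n} → Complex n → ℕ → Chain n → Set
K-den Δ i x = ∃ λ z → InC (face Δ) (suc i) z × (∀ σ → x σ ≡ Lap Δ z σ)

-- ℤ^Θ / im L̃  :  numerator and denominator
Q-num : ∀ {n} → Complex n → Complex n → ℕ → Chain n → Set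
Q-num Δ Υ i = InC (Θ Δ Υ i) (suc i)

Q-den : ∀ {n} → Complex n → Complex n → ℕ → Chain n → Set
Q-den Δ Υ i x = ∃ λ z → Q-num Δ Υ i z × (∀ σ → x σ ≡ redLap Δ Υ i z σ)

-- A group isomorphism P₁/N₁ ≅ P₂/N₂ between subquotients of the chain
-- group ℤ-chains (Pᵢ ⊇ Nᵢ subgroups): a map on representatives which is
-- well defined, additive, injective and surjective on the quotients.

_⊕_ : ∀ {n} → Chain n → Chain n → Chain n
(x ⊕ y) σ = x σ ℤ.+ y σ

_⊖_ : ∀ {n} → Chain n → Chain n → Chain n
(x ⊖ y) σ = x σ ℤ.- y σ

record SubquotientIso {n} (P₁ N₁ P₂ N₂ : Chain n → Set) : Set where
  field
    φ     : Chain n → Chain n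
    φ-P   : ∀ x → P₁ x → P₂ (φ x)
    φ-wd  : ∀ x y → P₁ x → P₁ y → N₁ (x ⊖ y) → N₂ (φ x ⊖ φ y)
    φ-hom : ∀ x y → P₁ x → P₁ y → N₂ (φ (x ⊕ y) ⊖ (φ x ⊕ φ y))
    φ-inj : ∀ x y → P₁ x → P₁ y → N₂ (φ x ⊖ φ y) → N₁ (x ⊖ y)
    φ-surj : ∀ w → P₂ w → ∃ λ x → P₁ x × N₂ (φ x ⊖ w)

{-# OPTIONS --safe #-}
module Submission where

-- Restriction to Θ maps ker ∂_i isomorphically onto ℤ^Θ: it is injective
-- because Υ carries no i-cycle, and surjective because H̃_{i-1}(Υ;ℤ) = 0.
-- It matches the two images as soon as L C_i(Δ) = L ℤ^Θ.  Since L ∂* = 0,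
-- this follows if every i-cochain of Υ is a coboundary of Υ.  Now
-- ker ∂_{i-1} is a direct summand of C_{i-1}(Υ) (the image of ∂_{i-1} being
-- free), and ∂_i : C_i(Υ) → ker ∂_{i-1} is bijective, so ∂_i has a left inverse
-- over ℤ, whose transpose is a right inverse of ∂*_i.

open import Defs
open import Data.Nat using (ℕ; _≤_; _<_)

open import Data.Bool using (Bool; true; false; if_then_else_; T; _∧_; not)
open import Data.Bool.Properties using (T?; T-∧)
open import Data.Empty using (⊥-elim)
open import Data.Fin using (Fin; zero; suc)
open import Data.Fin.Subset using (Subset; _⊆_; ∣_∣)
open import Data.Integer using (ℤ; +_; -[1+_]; 0ℤ; 1ℤ; -1ℤ; _+_; _*_; _-_; -_; ≢-nonZero)
open import Data.Integer.Divisibility.Signed using (divides; ∣ᵤ⇒∣)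
open import Data.Integer.Properties using (_≟_; +-identityˡ; +-identityʳ; *-zeroʳ; *-identityˡ; *-comm; -1*i≡-i; pos-*; i-j≡0⇒i≡j; i≡j⇒i-j≡0; *-cancelˡ-≡)
open import Data.Integer.Tactic.RingSolver using (solve-∀)
open import Data.Nat.GCD using (mkGCD; module GCD; module Bézout)
import Data.Nat.Properties as ℕP
import Data.Nat as ℕ
import Data.Integer as ℤ
open import Data.Product using (∃; ∃₂; _×_; _,_; proj₁; proj₂)
open import Data.Sum using (_⊎_; inj₁; inj₂; map₁)
open import Data.Vec using ([]; _∷_; lookup; _[_]≔_; here; there)
open import Function using (_∘_; Equivalence)
open import Relation.Binary.PropositionalEquality using (_≡_; refl; sym; trans; cong; cong₂; subst; module ≡-Reasoning)
open import Relation.Nullary using (¬_; yes; no)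

open ℤC using (Chain; sgn; ∑; InC; IsCycle; ∂; δ)

private
  variable
    n : ℕ
    I J : Set

-- Linear maps

-- Chains are functions without extensionality, so the combination is supplied as a pointwise
-- hypothesis on a third argument `z`. Linearity in this form already contains respect for pointwise
-- equality, which is the case of coefficients 1 and 0.
LinearForm : ((I → ℤ) → ℤ) → Set
LinearForm {I} Y = ∀ a b {x y z : I → ℤ} → (∀ i → z i ≡ a * x i + b * y i) →
                   Y z ≡ a * Y x + b * Y y

Linear : ((I → ℤ) → (J → ℤ)) → Set
Linear f = ∀ j → LinearForm (λ x → f x j)

combination-zero : ∀ a b → a * 0ℤ + b * 0ℤ ≡ 0ℤ
combination-zero = solve-∀

one-zero-combination : ∀ p → p ≡ 1ℤ * p + 0ℤ * p
one-zero-combination = solve-∀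

form-cong : {Y : (I → ℤ) → ℤ} → LinearForm Y → ∀ {x y} → (∀ i → x i ≡ y i) → Y x ≡ Y y
form-cong {Y = Y} lin {x} {y} x≡y =
  trans (lin 1ℤ 0ℤ {y} {y} (λ i → trans (x≡y i) (one-zero-combination (y i)))) (sym (one-zero-combination (Y y)))

form-zero : {Y : (I → ℤ) → ℤ} → LinearForm Y → ∀ {x} → (∀ i → x i ≡ 0ℤ) → Y x ≡ 0ℤ
form-zero lin {x} x≡0 = lin 0ℤ 0ℤ {x} {x} x≡0

form-neg : {Y : (I → ℤ) → ℤ} → LinearForm Y → ∀ {x y} → (∀ i → x i ≡ - y i) → Y x ≡ - Y y
form-neg {Y = Y} lin {x} {y} x≡-y =
  trans (lin -1ℤ 0ℤ {y} {y} (λ i → trans (x≡-y i) (neg (y i)))) (sym (neg (Y y)))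
  where
  neg : ∀ p → - p ≡ -1ℤ * p + 0ℤ * p
  neg = solve-∀

form-add : {Y : (I → ℤ) → ℤ} → LinearForm Y → ∀ {x y z} → (∀ i → z i ≡ x i + y i) → Y z ≡ Y x + Y y
form-add {Y = Y} lin {x} {y} z≡x+y =
  trans (lin 1ℤ 1ℤ (λ i → trans (z≡x+y i) (add (x i) (y i)))) (sym (add (Y x) (Y y)))
  where
  add : ∀ p q → p + q ≡ 1ℤ * p + 1ℤ * q
  add = solve-∀

sub-combination : ∀ p q → p - q ≡ 1ℤ * p + -1ℤ * q
sub-combination = solve-∀

form-sub : {Y : (I → ℤ) → ℤ} → LinearForm Y → ∀ {x y z} → (∀ i → z i ≡ x i - y i) → Y z ≡ Y x - Y y
form-sub {Y = Y} lin {x} {y} z≡x-y =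
  trans (lin 1ℤ -1ℤ (λ i → trans (z≡x-y i) (sub-combination (x i) (y i)))) (sym (sub-combination (Y x) (Y y)))

-- A chain on `suc n` vertices splits into its part on faces containing the first vertex and its
-- part on faces avoiding it. This decomposition drives the inductions on the number of vertices.
join : Chain n → Chain n → Chain (ℕ.suc n)
join x y (true ∷ σ) = x σ
join x y (false ∷ σ) = y σ

left-form : {Y : Chain (ℕ.suc n) → ℤ} → LinearForm Y → LinearForm (λ x → Y (join x (λ _ → 0ℤ)))
left-form lin a b z≡ = lin a b λ { (true ∷ σ) → z≡ σ ; (false ∷ σ) → sym (combination-zero a b) }

right-form : {Y : Chain (ℕ.suc n) → ℤ} → LinearForm Y → LinearForm (λ x → Y (join (λ _ → 0ℤ) x))
right-form lin a b z≡ = lin a b λ { (false ∷ σ) → z≡ σ ; (true ∷ σ) → sym (combination-zero a b) }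

form-join : {Y : Chain (ℕ.suc n) → ℤ} → LinearForm Y → ∀ x →
            Y x ≡ Y (join (x ∘ (true ∷_)) (λ _ → 0ℤ)) + Y (join (λ _ → 0ℤ) (x ∘ (false ∷_)))
form-join lin x = form-add lin λ { (true ∷ σ) → sym (+-identityʳ _) ; (false ∷ σ) → sym (+-identityˡ _) }

-- Kernels of integer linear maps are direct summands

abs-multiple : ∀ i → ∃ λ s → + ℤ.∣ i ∣ ≡ s * i
abs-multiple (+ m) = 1ℤ , sym (*-identityˡ (+ m))
abs-multiple i@(-[1+ m ]) = -1ℤ , sym (-1*i≡-i i)

-- The combination `u * g + v * h` is the gcd of `g` and `h`. Stating only that it divides both also
-- covers the case where both vanish.
bézout : ∀ g h → ∃₂ λ u v → ∃₂ λ a b →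
         (g ≡ (u * g + v * h) * a) × (h ≡ (u * g + v * h) * b)
bézout g h
  with d , isGCD ← mkGCD ℤ.∣ g ∣ ℤ.∣ h ∣
     | s , |g|≡ ← abs-multiple g
     | t , |h|≡ ← abs-multiple h
  with divides a g≡ ← ∣ᵤ⇒∣ {+ d} {g} (GCD.gcd∣m isGCD)
     | divides b h≡ ← ∣ᵤ⇒∣ {+ d} {h} (GCD.gcd∣n isGCD) = combine (Bézout.identity isGCD)
  where
  from : ∀ {u v} → + d ≡ u * g + v * h → ∃₂ λ u v → ∃₂ λ a b →
         (g ≡ (u * g + v * h) * a) × (h ≡ (u * g + v * h) * b)
  from {u} {v} d≡ = u , v , a , b ,
    trans g≡ (trans (*-comm a (+ d)) (cong (_* a) d≡)) ,
    trans h≡ (trans (*-comm b (+ d)) (cong (_* b) d≡))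

  cast : ∀ x m y k → d ℕ.+ y ℕ.* k ≡ x ℕ.* m → + d + + y * + k ≡ + x * + m
  cast x m y k eq = begin
    + d + + y * + k      ≡⟨ cong (λ p → + d + p) (pos-* y k) ⟨
    + (d ℕ.+ y ℕ.* k)    ≡⟨ cong +_ eq ⟩
    + (x ℕ.* m)          ≡⟨ pos-* x m ⟩
    + x * + m            ∎
    where open ≡-Reasoning

  move : ∀ {p q} → + d + p ≡ q → + d ≡ q - p
  move {p} refl = rearrange (+ d) p
    where
    rearrange : ∀ d p → d ≡ d + p - p
    rearrange = solve-∀

  combine : Bézout.Identity d ℤ.∣ g ∣ ℤ.∣ h ∣ → _
  -- Over ℕ the identity reads `d + y|h| = x|g|`. One term is moved across, and the signs `s` and
  -- `t` convert absolute values into multiples of `g` and `h`.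
  combine (Bézout.+- x y eq) = from {+ x * s} { - (+ y * t)} (trans
    (move (trans (cong (λ k → + d + + y * k) (sym |h|≡)) (trans (cast x _ y _ eq) (cong (λ p → + x * p) |g|≡))))
    (rearrange (+ x) (+ y) s t g h))
    where
    rearrange : ∀ x y s t g h → x * (s * g) - y * (t * h) ≡ x * s * g + - (y * t) * h
    rearrange = solve-∀
  combine (Bézout.-+ x y eq) = from { - (+ x * s)} {+ y * t} (trans
    (move (trans (cong (λ k → + d + + x * k) (sym |g|≡)) (trans (cast y _ x _ eq) (cong (+ y *_) |h|≡))))
    (rearrange (+ x) (+ y) s t g h))
    where
    rearrange : ∀ x y s t g h → y * (t * h) - x * (s * g) ≡ - (x * s) * g + y * t * h
    rearrange = solve-∀

-- The image of an integral form is an ideal of ℤ, hence generated by a single value `f c`. By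
-- induction the two halves of a chain have generators `gₜ` and `g₀`; `c` combines their preimages
-- with the Bézout coefficients. The quotient `f′` is built as a linear form outright, so nothing
-- has to be divided when `f c` is zero.
image-principal : (f : Chain n → ℤ) → LinearForm f →
                  ∃₂ λ c f′ → LinearForm f′ × (∀ x → f x ≡ f c * f′ x)
image-principal {ℕ.zero} f lin = (λ _ → 1ℤ) , (λ x → x []) , (λ a b z≡ → z≡ []) , λ x →
  trans (lin (x []) 0ℤ {λ _ → 1ℤ} {λ _ → 1ℤ} λ { [] → scale (x []) }) (unscale (x []) _)
  where
  scale : ∀ p → p ≡ p * 1ℤ + 0ℤ * 1ℤ
  scale = solve-∀
  unscale : ∀ p q → p * q + 0ℤ * q ≡ q * p
  unscale = solve-∀
image-principal {ℕ.suc n} f lin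
  with cₜ , f′ₜ , lin′ₜ , fₜ≡ ← image-principal _ (left-form lin)
     | c₀ , f′₀ , lin′₀ , f₀≡ ← image-principal _ (right-form lin)
  with u , v , a , b , gₜ≡ , g₀≡ ← bézout (f (join cₜ (λ _ → 0ℤ))) (f (join (λ _ → 0ℤ) c₀)) =
  c , f′ , lin′ , λ x → begin
    f x                                       ≡⟨ form-join lin x ⟩
    _                                         ≡⟨ cong₂ _+_ (fₜ≡ _) (f₀≡ _) ⟩
    gₜ * f′ₜ (x ∘ (true ∷_)) + g₀ * f′₀ (x ∘ (false ∷_))
      ≡⟨ cong₂ (λ p q → p * f′ₜ (x ∘ (true ∷_)) + q * f′₀ (x ∘ (false ∷_))) gₜ≡ g₀≡ ⟩
    _                                         ≡⟨ factor (u * gₜ + v * g₀) a b _ _ ⟩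
    (u * gₜ + v * g₀) * f′ x                  ≡⟨ cong (_* f′ x) fc≡ ⟨
    f c * f′ x                                ∎
  where
  open ≡-Reasoning
  gₜ = f (join cₜ (λ _ → 0ℤ))
  g₀ = f (join (λ _ → 0ℤ) c₀)

  c : Chain (ℕ.suc n)
  c = join (λ σ → u * cₜ σ) (λ σ → v * c₀ σ)

  f′ : Chain (ℕ.suc n) → ℤ
  f′ x = a * f′ₜ (x ∘ (true ∷_)) + b * f′₀ (x ∘ (false ∷_))

  lin′ : LinearForm f′
  lin′ k l z≡ = trans
    (cong₂ (λ p q → a * p + b * q) (lin′ₜ k l (z≡ ∘ (true ∷_))) (lin′₀ k l (z≡ ∘ (false ∷_))))
    (shuffle a b k l _ _ _ _)
    where
    shuffle : ∀ a b k l p q r s →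
              a * (k * p + l * q) + b * (k * r + l * s) ≡ k * (a * p + b * r) + l * (a * q + b * s)
    shuffle = solve-∀

  fc≡ : f c ≡ u * gₜ + v * g₀
  fc≡ = lin u v λ { (true ∷ σ) → onlyₜ u v (cₜ σ) ; (false ∷ σ) → only₀ u v (c₀ σ) }
    where
    onlyₜ : ∀ u v p → u * p ≡ u * p + v * 0ℤ
    onlyₜ = solve-∀
    only₀ : ∀ u v p → v * p ≡ u * 0ℤ + v * p
    only₀ = solve-∀

  factor : ∀ d a b p q → d * a * p + d * b * q ≡ d * (a * p + b * q)
  factor = solve-∀

-- The splitting is recorded as a linear retraction of all chains onto `ker f`.
KernelProjection : (Chain n → J → ℤ) → Set
KernelProjection {n} f = ∃ λ (p : Chain n → Chain n) → Linear p ×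
  (∀ x j → f (p x) j ≡ 0ℤ) × (∀ x → (∀ j → f x j ≡ 0ℤ) → ∀ σ → p x σ ≡ x σ)

-- If f = f c * f′ with f c ≠ 0, then f′ c = 1, so x − f′ x * c projects onto ker f.
kernel-projection-form : (f : Chain n → Chain 0) → Linear f → KernelProjection f
kernel-projection-form f lin
  with c , f′ , lin′ , f≡ ← image-principal (λ x → f x []) (lin [])
  with f c [] ≟ 0ℤ
... | yes fc≡0 = (λ x → x) , (λ σ a b z≡ → z≡ σ) ,
      (λ { x [] → trans (f≡ x) (cong (_* f′ x) fc≡0) }) , (λ x _ σ → refl)
... | no fc≢0 = (λ x σ → x σ - f′ x * c σ) , lin-p , kills , fixes
  where
  instance _ = ≢-nonZero fc≢0

  lin-p : Linear (λ x σ → x σ - f′ x * c σ)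
  lin-p σ a b z≡ = trans (cong₂ (λ p q → p - q * c σ) (z≡ σ) (lin′ a b z≡)) (shuffle a b (c σ) _ _ _ _)
    where
    shuffle : ∀ a b c p q r s →
              a * p + b * q - (a * r + b * s) * c ≡ a * (p - r * c) + b * (q - s * c)
    shuffle = solve-∀

  kills : ∀ x j → f (λ σ → x σ - f′ x * c σ) j ≡ 0ℤ
  kills x [] = trans (lin [] 1ℤ (- f′ x) (λ σ → as-combination (x σ) (f′ x) (c σ)))
    (trans (cong (λ k → 1ℤ * k + - f′ x * f c []) (f≡ x)) (cancel (f c []) (f′ x)))
    where
    as-combination : ∀ p q r → p - q * r ≡ 1ℤ * p + - q * r
    as-combination = solve-∀
    cancel : ∀ p q → 1ℤ * (p * q) + - q * p ≡ 0ℤ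
    cancel = solve-∀

  fixes : ∀ x → (∀ j → f x j ≡ 0ℤ) → ∀ σ → x σ - f′ x * c σ ≡ x σ
  fixes x fx≡0 σ = trans (cong (λ k → x σ - k * c σ) f′x≡0) (drop (x σ) (c σ))
    where
    f′x≡0 : f′ x ≡ 0ℤ
    f′x≡0 = *-cancelˡ-≡ (f c []) (f′ x) 0ℤ
      (trans (sym (f≡ x)) (trans (fx≡0 []) (sym (*-zeroʳ (f c [])))))
    drop : ∀ p c → p - 0ℤ * c ≡ p
    drop = solve-∀

-- The coordinates of `f` are killed by induction on the vertices of the target: first those indexed
-- by subsets containing the first vertex, then the others.
kernel-projection : ∀ {m} (f : Chain n → Chain m) → Linear f → KernelProjection f
kernel-projection {m = ℕ.zero} f lin = kernel-projection-form f lin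
kernel-projection {m = ℕ.suc m} f lin
  with p , lin-p , p-kills , p-fixes ← kernel-projection (λ x τ → f x (true ∷ τ)) (λ τ → lin (true ∷ τ))
  -- The second projection is taken for `f ∘ p` instead of `f`, so that applying `p` afterwards
  -- leaves the remaining coordinates zero.
  with q , lin-q , q-kills , q-fixes ← kernel-projection (λ x τ → f (p x) (false ∷ τ))
         (λ τ a b z≡ → lin (false ∷ τ) a b (λ σ → lin-p σ a b z≡)) =
  p ∘ q , (λ σ a b z≡ → lin-p σ a b (λ ρ → lin-q ρ a b z≡)) , kills , fixes
  where
  kills : ∀ x j → f (p (q x)) j ≡ 0ℤ
  kills x (true ∷ τ) = p-kills (q x) τ
  kills x (false ∷ τ) = q-kills x τ

  fixes : ∀ x → (∀ j → f x j ≡ 0ℤ) → ∀ σ → p (q x) σ ≡ x σ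
  fixes x fx≡0 σ = trans (form-cong (lin-p σ) qx≡x) (px≡x σ)
    where
    px≡x : ∀ σ → p x σ ≡ x σ
    px≡x = p-fixes x (fx≡0 ∘ (true ∷_))
    qx≡x : ∀ σ → q x σ ≡ x σ
    qx≡x = q-fixes x (λ τ → trans (form-cong (lin (false ∷ τ)) px≡x) (fx≡0 (false ∷ τ)))

-- Boundary and coboundary

∑-neg : ∀ {m} {f g : Fin m → ℤ} → (∀ j → f j ≡ - g j) → ∑ f ≡ - ∑ g
∑-neg {ℕ.zero} f≡-g = refl
∑-neg {ℕ.suc m} {f} {g} f≡-g =
  trans (cong₂ _+_ (f≡-g zero) (∑-neg (f≡-g ∘ suc))) (neg-+ (g zero) _)
  where
  neg-+ : ∀ p q → - p + - q ≡ - (p + q)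
  neg-+ = solve-∀

∑-zero : ∀ {m} {f : Fin m → ℤ} → (∀ j → f j ≡ 0ℤ) → ∑ f ≡ 0ℤ
∑-zero {ℕ.zero} f≡0 = refl
∑-zero {ℕ.suc m} f≡0 = cong₂ _+_ (f≡0 zero) (∑-zero (f≡0 ∘ suc))

∑-cong : ∀ {m} {f g : Fin m → ℤ} → (∀ j → f j ≡ g j) → ∑ f ≡ ∑ g
∑-cong {ℕ.zero} f≡g = refl
∑-cong {ℕ.suc m} f≡g = cong₂ _+_ (f≡g zero) (∑-cong (f≡g ∘ suc))

-- A first vertex in the face shifts every later position by one and so flips all signs. Together
-- with `∂-false` this presents the chains on `suc n` vertices as the mapping cone of the identity;
-- the two recursions for `δ⁺` are the transposes.
∂-true : (x : Chain (ℕ.suc n)) → ∀ τ → ∂ x (true ∷ τ) ≡ - ∂ (x ∘ (true ∷_)) τ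
∂-true x τ = trans (+-identityˡ _) (∑-neg λ v → term (lookup τ v) (sgn (below τ v)) (x (true ∷ (τ [ v ]≔ true))))
  where
  neg-* : ∀ s y → - s * y ≡ - (s * y)
  neg-* = solve-∀
  term : ∀ b s y → (if b then 0ℤ else - s * y) ≡ - (if b then 0ℤ else s * y)
  term true s y = refl
  term false s y = neg-* s y

∂-false : (x : Chain (ℕ.suc n)) → ∀ τ → ∂ x (false ∷ τ) ≡ x (true ∷ τ) + ∂ (x ∘ (false ∷_)) τ
∂-false x τ = cong (_+ ∂ (x ∘ (false ∷_)) τ) (*-identityˡ (x (true ∷ τ)))

-- The coboundary of the full simplex on all `n` vertices. By definition `δ K` is `δ⁺` followed by
-- truncation to `K`.
δ⁺ : Chain n → Chain n
δ⁺ = δ (λ _ → true)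

δ⁺-true : (x : Chain (ℕ.suc n)) → ∀ τ → δ⁺ x (true ∷ τ) ≡ x (false ∷ τ) - δ⁺ (x ∘ (true ∷_)) τ
δ⁺-true x τ = cong₂ _+_ (*-identityˡ (x (false ∷ τ)))
  (∑-neg λ v → term (lookup τ v) (sgn (below τ v)) (x (true ∷ (τ [ v ]≔ false))))
  where
  neg-* : ∀ s y → - s * y ≡ - (s * y)
  neg-* = solve-∀
  term : ∀ b s y → (if b then - s * y else 0ℤ) ≡ - (if b then s * y else 0ℤ)
  term true s y = neg-* s y
  term false s y = refl

δ⁺-false : (x : Chain (ℕ.suc n)) → ∀ τ → δ⁺ x (false ∷ τ) ≡ δ⁺ (x ∘ (false ∷_)) τ
δ⁺-false x τ = +-identityˡ _

∂-linear : Linear (∂ {n})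
∂-linear [] a b z≡ = sym (combination-zero a b)
∂-linear (true ∷ τ) a b {x} {y} {z} z≡ = begin
  ∂ z (true ∷ τ)               ≡⟨ ∂-true z τ ⟩
  - ∂ (z ∘ (true ∷_)) τ        ≡⟨ cong -_ (∂-linear τ a b (z≡ ∘ (true ∷_))) ⟩
  _                            ≡⟨ shuffle a b _ _ ⟩
  _                            ≡⟨ cong₂ (λ p q → a * p + b * q) (∂-true x τ) (∂-true y τ) ⟨
  _                            ∎
  where
  open ≡-Reasoning
  shuffle : ∀ a b p q → - (a * p + b * q) ≡ a * - p + b * - q
  shuffle = solve-∀
∂-linear (false ∷ τ) a b {x} {y} {z} z≡ = begin
  ∂ z (false ∷ τ)              ≡⟨ ∂-false z τ ⟩
  _                            ≡⟨ cong₂ _+_ (z≡ (true ∷ τ)) (∂-linear τ a b (z≡ ∘ (false ∷_))) ⟩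
  _                            ≡⟨ shuffle a b (x (true ∷ τ)) (y (true ∷ τ)) _ _ ⟩
  _                            ≡⟨ cong₂ (λ p q → a * p + b * q) (∂-false x τ) (∂-false y τ) ⟨
  _                            ∎
  where
  open ≡-Reasoning
  shuffle : ∀ a b p q r s → a * p + b * q + (a * r + b * s) ≡ a * (p + r) + b * (q + s)
  shuffle = solve-∀

δ⁺-linear : Linear (δ⁺ {n})
δ⁺-linear [] a b z≡ = sym (combination-zero a b)
δ⁺-linear (true ∷ τ) a b {x} {y} {z} z≡ = begin
  δ⁺ z (true ∷ τ)              ≡⟨ δ⁺-true z τ ⟩
  _                            ≡⟨ cong₂ _-_ (z≡ (false ∷ τ)) (δ⁺-linear τ a b (z≡ ∘ (true ∷_))) ⟩
  _                            ≡⟨ shuffle a b (x (false ∷ τ)) (y (false ∷ τ)) _ _ ⟩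
  _                            ≡⟨ cong₂ (λ p q → a * p + b * q) (δ⁺-true x τ) (δ⁺-true y τ) ⟨
  _                            ∎
  where
  open ≡-Reasoning
  shuffle : ∀ a b p q r s → a * p + b * q - (a * r + b * s) ≡ a * (p - r) + b * (q - s)
  shuffle = solve-∀
δ⁺-linear (false ∷ τ) a b {x} {y} {z} z≡ = begin
  δ⁺ z (false ∷ τ)             ≡⟨ δ⁺-false z τ ⟩
  _                            ≡⟨ δ⁺-linear τ a b (z≡ ∘ (false ∷_)) ⟩
  _                            ≡⟨ cong₂ (λ p q → a * p + b * q) (δ⁺-false x τ) (δ⁺-false y τ) ⟨
  _                            ∎
  where open ≡-Reasoning

∂∂≡0 : (x : Chain n) → ∀ τ → ∂ (∂ x) τ ≡ 0ℤ
∂∂≡0 x [] = refl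
∂∂≡0 x (true ∷ τ) = begin
  ∂ (∂ x) (true ∷ τ)               ≡⟨ ∂-true (∂ x) τ ⟩
  - ∂ (∂ x ∘ (true ∷_)) τ          ≡⟨ cong -_ (form-neg (∂-linear τ) (∂-true x)) ⟩
  - - ∂ (∂ (x ∘ (true ∷_))) τ      ≡⟨ cong (λ p → - - p) (∂∂≡0 (x ∘ (true ∷_)) τ) ⟩
  0ℤ                               ∎
  where open ≡-Reasoning
∂∂≡0 x (false ∷ τ) = begin
  ∂ (∂ x) (false ∷ τ)                            ≡⟨ ∂-false (∂ x) τ ⟩
  _                                              ≡⟨ cong₂ _+_ (∂-true x τ) (form-add (∂-linear τ) {x₁} {∂ (x ∘ (false ∷_))} (∂-false x)) ⟩
  _                                              ≡⟨ cong (λ p → - ∂ x₁ τ + (∂ x₁ τ + p)) (∂∂≡0 (x ∘ (false ∷_)) τ) ⟩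
  - ∂ x₁ τ + (∂ x₁ τ + 0ℤ)                       ≡⟨ cancel (∂ x₁ τ) ⟩
  0ℤ                                             ∎
  where
  open ≡-Reasoning
  x₁ = x ∘ (true ∷_)
  cancel : ∀ p → - p + (p + 0ℤ) ≡ 0ℤ
  cancel = solve-∀

δ⁺δ⁺≡0 : (x : Chain n) → ∀ τ → δ⁺ (δ⁺ x) τ ≡ 0ℤ
δ⁺δ⁺≡0 x [] = refl
δ⁺δ⁺≡0 x (false ∷ τ) = begin
  δ⁺ (δ⁺ x) (false ∷ τ)            ≡⟨ δ⁺-false (δ⁺ x) τ ⟩
  δ⁺ (δ⁺ x ∘ (false ∷_)) τ         ≡⟨ form-cong (δ⁺-linear τ) (δ⁺-false x) ⟩
  δ⁺ (δ⁺ (x ∘ (false ∷_))) τ       ≡⟨ δ⁺δ⁺≡0 (x ∘ (false ∷_)) τ ⟩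
  0ℤ                               ∎
  where open ≡-Reasoning
δ⁺δ⁺≡0 x (true ∷ τ) = begin
  δ⁺ (δ⁺ x) (true ∷ τ)                           ≡⟨ δ⁺-true (δ⁺ x) τ ⟩
  _                                              ≡⟨ cong₂ _-_ (δ⁺-false x τ) (form-sub (δ⁺-linear τ) {x₀} {δ⁺ (x ∘ (true ∷_))} (δ⁺-true x)) ⟩
  _                                              ≡⟨ cong (λ p → δ⁺ x₀ τ - (δ⁺ x₀ τ - p)) (δ⁺δ⁺≡0 (x ∘ (true ∷_)) τ) ⟩
  δ⁺ x₀ τ - (δ⁺ x₀ τ - 0ℤ)                       ≡⟨ cancel (δ⁺ x₀ τ) ⟩
  0ℤ                                             ∎
  where
  open ≡-Reasoning
  x₀ = x ∘ (false ∷_)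
  cancel : ∀ p → p - (p - 0ℤ) ≡ 0ℤ
  cancel = solve-∀

-- Basis chains and the adjointness of boundary and coboundary

basis : Subset n → Chain n
basis [] = λ _ → 1ℤ
basis (true ∷ σ) = join (basis σ) (λ _ → 0ℤ)
basis (false ∷ σ) = join (λ _ → 0ℤ) (basis σ)

basis-support : (σ τ : Subset n) → σ ≡ τ ⊎ basis σ τ ≡ 0ℤ
basis-support [] [] = inj₁ refl
basis-support (true ∷ σ) (true ∷ τ) = map₁ (cong (true ∷_)) (basis-support σ τ)
basis-support (true ∷ σ) (false ∷ τ) = inj₂ refl
basis-support (false ∷ σ) (true ∷ τ) = inj₂ refl
basis-support (false ∷ σ) (false ∷ τ) = map₁ (cong (false ∷_)) (basis-support σ τ)

-- The standard inner product, summed along the recursion on vertices.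
dual-form : Chain n → Chain n → ℤ
dual-form {ℕ.zero} z x = z [] * x []
dual-form {ℕ.suc n} z x = dual-form (z ∘ (true ∷_)) (x ∘ (true ∷_)) + dual-form (z ∘ (false ∷_)) (x ∘ (false ∷_))

dual-form-linear : (z : Chain n) → LinearForm (dual-form z)
dual-form-linear {ℕ.zero} z a b w≡ = trans (cong (z [] *_) (w≡ [])) (shuffle (z []) a b _ _)
  where
  shuffle : ∀ z a b p q → z * (a * p + b * q) ≡ a * (z * p) + b * (z * q)
  shuffle = solve-∀
dual-form-linear {ℕ.suc n} z a b w≡ = trans
  (cong₂ _+_ (dual-form-linear _ a b (w≡ ∘ (true ∷_))) (dual-form-linear _ a b (w≡ ∘ (false ∷_))))
  (shuffle a b _ _ _ _)
  where
  shuffle : ∀ a b p q r s → a * p + b * q + (a * r + b * s) ≡ a * (p + r) + b * (q + s)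
  shuffle = solve-∀

dual-form-basis : (z : Chain n) → ∀ σ → dual-form z (basis σ) ≡ z σ
dual-form-basis z [] = unit (z [])
  where
  unit : ∀ p → p * 1ℤ ≡ p
  unit = solve-∀
dual-form-basis z (true ∷ σ) = trans
  (cong₂ _+_ (dual-form-basis (z ∘ (true ∷_)) σ) (form-zero (dual-form-linear (z ∘ (false ∷_))) (λ _ → refl)))
  (+-identityʳ _)
dual-form-basis z (false ∷ σ) = trans
  (cong₂ _+_ (form-zero (dual-form-linear (z ∘ (true ∷_))) (λ _ → refl)) (dual-form-basis (z ∘ (false ∷_)) σ))
  (+-identityˡ _)

-- This says that `δ⁺` is the transpose of `∂`. An arbitrary form `Y` stands in for an inner
-- product, so that the induction hypothesis applies to the restrictions of `Y` to the two halves.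
δ⁺-adjoint : {Y : Chain n → ℤ} → LinearForm Y → ∀ σ → δ⁺ (Y ∘ basis) σ ≡ Y (∂ (basis σ))
δ⁺-adjoint lin [] = sym (form-zero lin λ { [] → refl })
δ⁺-adjoint {Y = Y} lin (true ∷ σ) = begin
  δ⁺ (Y ∘ basis) (true ∷ σ)                                            ≡⟨ δ⁺-true (Y ∘ basis) σ ⟩
  Y (basis (false ∷ σ)) - δ⁺ (λ τ → Y (basis (true ∷ τ))) σ            ≡⟨ cong (λ p → Y (basis (false ∷ σ)) - p) (δ⁺-adjoint (left-form lin) σ) ⟩
  Y (basis (false ∷ σ)) - Y (join (∂ (basis σ)) (λ _ → 0ℤ))            ≡⟨ form-sub lin split ⟨
  Y (∂ (basis (true ∷ σ)))                                             ∎
  where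
  open ≡-Reasoning
  0- : ∀ p → - p ≡ 0ℤ - p
  0- = solve-∀
  -- Coning with the first vertex `v`: the boundary of `v * σ` is `σ` minus `v * ∂σ`.
  split : ∀ τ → ∂ (basis (true ∷ σ)) τ ≡ basis (false ∷ σ) τ - join (∂ (basis σ)) (λ _ → 0ℤ) τ
  split (true ∷ τ) = trans (∂-true (basis (true ∷ σ)) τ) (0- _)
  split (false ∷ τ) = trans (∂-false (basis (true ∷ σ)) τ)
    (cong (λ p → basis σ τ + p) (form-zero (∂-linear τ) (λ _ → refl)))
δ⁺-adjoint {Y = Y} lin (false ∷ σ) = begin
  δ⁺ (Y ∘ basis) (false ∷ σ)                     ≡⟨ δ⁺-false (Y ∘ basis) σ ⟩
  δ⁺ (λ τ → Y (basis (false ∷ τ))) σ             ≡⟨ δ⁺-adjoint (right-form lin) σ ⟩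
  Y (join (λ _ → 0ℤ) (∂ (basis σ)))              ≡⟨ form-cong lin split ⟨
  Y (∂ (basis (false ∷ σ)))                      ∎
  where
  open ≡-Reasoning
  split : ∀ τ → ∂ (basis (false ∷ σ)) τ ≡ join (λ _ → 0ℤ) (∂ (basis σ)) τ
  split (true ∷ τ) = trans (∂-true (basis (false ∷ σ)) τ) (cong -_ (form-zero (∂-linear τ) (λ _ → refl)))
  split (false ∷ τ) = trans (∂-false (basis (false ∷ σ)) τ) (+-identityˡ _)

-- Supports of chains

restrict : (Subset n → Bool) → Chain n → Chain n
restrict P x σ = if P σ then x σ else 0ℤ

restrict-in : (P : Subset n → Bool) (x : Chain n) → ∀ {σ} → T (P σ) → restrict P x σ ≡ x σ
restrict-in P x {σ} p with P σ
... | true = refl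

restrict-out : (P : Subset n → Bool) (x : Chain n) → ∀ {σ} → ¬ T (P σ) → restrict P x σ ≡ 0ℤ
restrict-out P x {σ} ¬p with P σ
... | true = ⊥-elim (¬p _)
... | false = refl

restrict-linear : (P : Subset n → Bool) → Linear (restrict P)
restrict-linear P σ a b z≡ with P σ
... | true = z≡ σ
... | false = sym (combination-zero a b)

δ-linear : (K : Subset n → Bool) → Linear (δ K)
δ-linear K σ a b z≡ = restrict-linear K σ a b (λ ρ → δ⁺-linear ρ a b z≡)

-- A Boolean form of the support condition in `InC`, so that restriction to it projects onto the
-- chain group.
layer : (Subset n → Bool) → ℕ → Subset n → Bool
layer K s σ = K σ ∧ (∣ σ ∣ ℕ.≡ᵇ s)

layer-intro : (K : Subset n → Bool) (s : ℕ) → ∀ {σ} → T (K σ) → ∣ σ ∣ ≡ s → T (layer K s σ)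
layer-intro K s k card = Equivalence.from T-∧ (k , ℕP.≡⇒≡ᵇ _ s card)

layer-elim : (K : Subset n → Bool) (s : ℕ) → ∀ {σ} → T (layer K s σ) → T (K σ) × ∣ σ ∣ ≡ s
layer-elim K s l with k , card ← Equivalence.to T-∧ l = k , ℕP.≡ᵇ⇒≡ _ s card

InC-layer : (K : Subset n → Bool) (s : ℕ) (x : Chain n) → InC K s (restrict (layer K s) x)
InC-layer K s x σ σ∉ = restrict-out (layer K s) x (σ∉ ∘ layer-elim K s)

restrict-layer : (K : Subset n → Bool) (s : ℕ) {x : Chain n} → InC K s x →
                 ∀ σ → restrict (layer K s) x σ ≡ x σ
restrict-layer K s {x} x∈ σ with T? (layer K s σ)
... | yes l = restrict-in (layer K s) x l
... | no ¬l = trans (restrict-out (layer K s) x ¬l) (sym (x∈ σ λ (k , card) → ¬l (layer-intro K s k card)))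

InC-combination : {K : Subset n → Bool} {s : ℕ} {x y z : Chain n} → InC K s x → InC K s y →
                  ∀ a b → (∀ σ → z σ ≡ a * x σ + b * y σ) → InC K s z
InC-combination x∈ y∈ a b z≡ σ σ∉ =
  trans (z≡ σ) (trans (cong₂ (λ p q → a * p + b * q) (x∈ σ σ∉) (y∈ σ σ∉)) (combination-zero a b))

InC-⊖ : {K : Subset n → Bool} {s : ℕ} {x y : Chain n} → InC K s x → InC K s y → InC K s (x ⊖ y)
InC-⊖ {x = x} {y} x∈ y∈ = InC-combination x∈ y∈ 1ℤ -1ℤ (λ σ → sub-combination (x σ) (y σ))

InC-mono : {K K′ : Subset n → Bool} {s : ℕ} {x : Chain n} →
           (∀ σ → ∣ σ ∣ ≡ s → T (K σ) → T (K′ σ)) → InC K s x → InC K′ s x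
InC-mono K⊆K′ x∈ σ σ∉ = x∈ σ λ (k , card) → σ∉ (K⊆K′ σ card k , card)

⊆-insert : (τ : Subset n) → ∀ v → τ ⊆ (τ [ v ]≔ true)
⊆-insert (b ∷ τ) zero here = here
⊆-insert (b ∷ τ) zero (there p) = there p
⊆-insert (b ∷ τ) (suc v) here = here
⊆-insert (b ∷ τ) (suc v) (there p) = there (⊆-insert τ v p)

delete-⊆ : (σ : Subset n) → ∀ v → (σ [ v ]≔ false) ⊆ σ
delete-⊆ (b ∷ σ) zero (there p) = there p
delete-⊆ (b ∷ σ) (suc v) here = here
delete-⊆ (b ∷ σ) (suc v) (there p) = there (delete-⊆ σ v p)

∣insert∣ : (τ : Subset n) → ∀ v → lookup τ v ≡ false → ∣ τ [ v ]≔ true ∣ ≡ ℕ.suc ∣ τ ∣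
∣insert∣ (false ∷ τ) zero v∉ = refl
∣insert∣ (true ∷ τ) (suc v) v∉ = cong ℕ.suc (∣insert∣ τ v v∉)
∣insert∣ (false ∷ τ) (suc v) v∉ = ∣insert∣ τ v v∉

∣delete∣ : (σ : Subset n) → ∀ v → lookup σ v ≡ true → ∣ σ ∣ ≡ ℕ.suc ∣ σ [ v ]≔ false ∣
∣delete∣ (true ∷ σ) zero v∈ = refl
∣delete∣ (true ∷ σ) (suc v) v∈ = cong ℕ.suc (∣delete∣ σ v v∈)
∣delete∣ (false ∷ σ) (suc v) v∈ = ∣delete∣ σ v v∈

∂-InC : (Δ : Complex n) {s : ℕ} {x : Chain n} → InC (face Δ) (ℕ.suc s) x → InC (face Δ) s (∂ x)
∂-InC Δ {s} {x} x∈ τ τ∉ = ∑-zero term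
  where
  term : ∀ v → (if lookup τ v then 0ℤ else sgn (below τ v) * x (τ [ v ]≔ true)) ≡ 0ℤ
  term v with lookup τ v in v∉
  ... | true = refl
  ... | false = trans (cong (sgn (below τ v) *_) (x∈ _ λ (k , card) →
          τ∉ (down-closed Δ (⊆-insert τ v) k , ℕP.suc-injective (trans (sym (∣insert∣ τ v v∉)) card))))
        (*-zeroʳ (sgn (below τ v)))

δ-InC : (K : Subset n → Bool) {s : ℕ} {x : Chain n} → InC K s x → InC K (ℕ.suc s) (δ K x)
δ-InC K {s} {x} x∈ σ σ∉ with T? (K σ)
... | no ¬k = restrict-out K (δ⁺ x) ¬k
... | yes k = trans (restrict-in K (δ⁺ x) k) (∑-zero term)
  where
  term : ∀ v → (if lookup σ v then sgn (below σ v) * x (σ [ v ]≔ false) else 0ℤ) ≡ 0ℤ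
  term v with lookup σ v in v∈
  ... | false = refl
  ... | true = trans (cong (sgn (below σ v) *_) (x∈ _ λ (_ , card) →
          σ∉ (k , trans (∣delete∣ σ v v∈) (cong ℕ.suc card))))
        (*-zeroʳ (sgn (below σ v)))

δδ≡0 : (Δ : Complex n) (x : Chain n) → ∀ σ → δ (face Δ) (δ (face Δ) x) σ ≡ 0ℤ
δδ≡0 Δ x σ with T? (face Δ σ)
... | no ¬k = restrict-out (face Δ) (δ⁺ (δ (face Δ) x)) ¬k
... | yes k = trans (restrict-in (face Δ) (δ⁺ (δ (face Δ) x)) k) (trans (∑-cong term) (δ⁺δ⁺≡0 x σ))
  where
  term : ∀ v → (if lookup σ v then sgn (below σ v) * δ (face Δ) x (σ [ v ]≔ false) else 0ℤ)
             ≡ (if lookup σ v then sgn (below σ v) * δ⁺ x (σ [ v ]≔ false) else 0ℤ)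
  -- Every facet of a face of `Δ` lies in `Δ`, so truncating the inner coboundary to `Δ` changes no
  -- term at `σ`.
  term v = cong (λ p → if lookup σ v then sgn (below σ v) * p else 0ℤ)
    (restrict-in (face Δ) (δ⁺ x) (down-closed Δ (delete-⊆ σ v) k))

Lap-linear : (Δ : Complex n) → Linear (Lap Δ)
Lap-linear Δ τ a b z≡ = ∂-linear τ a b (λ σ → δ-linear (face Δ) σ a b z≡)

Lap-InC : (Δ : Complex n) {s : ℕ} {x : Chain n} → InC (face Δ) s x → InC (face Δ) s (Lap Δ x)
Lap-InC Δ x∈ = ∂-InC Δ (δ-InC (face Δ) x∈)

basis-InC : (K : Subset n → Bool) → ∀ {σ} → T (K σ) → InC K ∣ σ ∣ (basis σ)
basis-InC K {σ} k τ τ∉ with basis-support σ τ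
... | inj₁ refl = ⊥-elim (τ∉ (k , refl))
... | inj₂ zero-at-τ = zero-at-τ

-- Vanishing of top cohomology

-- The cochain `y` is the transpose of the left inverse `u` applied to `z`: its coboundary at `σ`
-- pairs `z` with `u` of the boundary of the basis chain of `σ`, which is that basis chain again.
transpose-section : (Υ : Complex n) (s : ℕ) (u : Chain n → Chain n) → Linear u →
  (∀ x → InC (face Υ) (ℕ.suc s) x → ∀ σ → u (∂ x) σ ≡ x σ) →
  ∀ z → ∃ λ y → InC (face Υ) s y × (∀ σ → T (face Υ σ) → ∣ σ ∣ ≡ ℕ.suc s → δ⁺ y σ ≡ z σ)
transpose-section {n} Υ s u u-linear u-section z = Y ∘ basis , Y∈ , extends
  where
  R : Chain n → Chain n
  R = restrict (layer (face Υ) s)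

  zu : Chain n → ℤ
  zu x = dual-form z (u x)

  zu-linear : LinearForm zu
  zu-linear a b {x} {y} {w} w≡ = dual-form-linear z a b {u x} {u y} {u w} (λ σ → u-linear σ a b w≡)

  -- Inserting `R` forces `Y ∘ basis` to vanish off the faces of `Υ` of size `s`, and it leaves
  -- boundaries of chains of `Υ` unchanged.
  Y : Chain n → ℤ
  Y x = zu (R x)

  Y-linear : LinearForm Y
  Y-linear a b {x} {y} {w} w≡ =
    zu-linear a b {R x} {R y} {R w} (λ σ → restrict-linear (layer (face Υ) s) σ a b w≡)

  Y∈ : InC (face Υ) s (Y ∘ basis)
  Y∈ τ τ∉ = form-zero {Y = zu} zu-linear {R (basis τ)} R-basis≡0
    where
    R-basis≡0 : ∀ σ → R (basis τ) σ ≡ 0ℤ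
    R-basis≡0 σ with T? (layer (face Υ) s σ)
    ... | no ¬l = restrict-out (layer (face Υ) s) (basis τ) ¬l
    ... | yes l with basis-support τ σ
    ...   | inj₁ refl = ⊥-elim (τ∉ (layer-elim (face Υ) s l))
    ...   | inj₂ eq = trans (restrict-in (layer (face Υ) s) (basis τ) l) eq

  extends : ∀ σ → T (face Υ σ) → ∣ σ ∣ ≡ ℕ.suc s → δ⁺ (Y ∘ basis) σ ≡ z σ
  extends σ k card = begin
    δ⁺ (Y ∘ basis) σ         ≡⟨ δ⁺-adjoint {Y = Y} Y-linear σ ⟩
    zu (R (∂ (basis σ)))     ≡⟨ form-cong {Y = zu} zu-linear {R (∂ (basis σ))} {∂ (basis σ)}
                                  (restrict-layer (face Υ) s (∂-InC Υ eσ∈)) ⟩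
    zu (∂ (basis σ))         ≡⟨ form-cong {Y = dual-form z} (dual-form-linear z) {u (∂ (basis σ))} {basis σ}
                                  (u-section (basis σ) eσ∈) ⟩
    dual-form z (basis σ)    ≡⟨ dual-form-basis z σ ⟩
    z σ                      ∎
    where
    open ≡-Reasoning
    eσ∈ : InC (face Υ) (ℕ.suc s) (basis σ)
    eσ∈ = subst (λ t → InC (face Υ) t (basis σ)) card (basis-InC (face Υ) k)

module _ (Υ : Complex n) (s : ℕ)
         (no-cycles : ∀ x → IsCycle (face Υ) (ℕ.suc s) x → ∀ σ → x σ ≡ 0ℤ)
         (acyclic : ℤC.Acyclic (face Υ) s) where

  ∂-injective : ∀ {x y} → InC (face Υ) (ℕ.suc s) x → InC (face Υ) (ℕ.suc s) y →
                (∀ τ → ∂ x τ ≡ ∂ y τ) → ∀ σ → x σ ≡ y σ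
  ∂-injective {x} {y} x∈ y∈ ∂x≡∂y σ = i-j≡0⇒i≡j (x σ) (y σ) (no-cycles (x ⊖ y) (InC-⊖ x∈ y∈ ,
    λ τ → trans (form-sub (∂-linear τ) {x} {y} (λ _ → refl)) (i≡j⇒i-j≡0 (∂x≡∂y τ))) σ)

  -- A chain is projected to a cycle of `Υ` and then filled using acyclicity. The fillings are
  -- chosen one at a time, but each is unique because `∂` is injective, and uniqueness makes the
  -- choice linear.
  ∂-section : ∃ λ (u : Chain n → Chain n) → Linear u ×
              (∀ x → InC (face Υ) (ℕ.suc s) x → ∀ σ → u (∂ x) σ ≡ x σ)
  -- The kernel of `∂ ∘ R` is used because `p x` may have support outside `Υ`; it is `R (p x)` that
  -- is a cycle of `Υ`.
  ∂-section with p , p-linear , p-kills , p-fixes ← kernel-projection (∂ ∘ restrict (layer (face Υ) s))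
                 (λ τ a b z≡ → ∂-linear τ a b (λ σ → restrict-linear (layer (face Υ) s) σ a b z≡)) =
    u , u-linear , u-section
    where
    R : Chain n → Chain n
    R = restrict (layer (face Υ) s)

    filling : ∀ x → ℤC.IsBoundary (face Υ) s (R (p x))
    filling x = acyclic (R (p x)) (InC-layer (face Υ) s (p x) , p-kills x)

    u : Chain n → Chain n
    u x = proj₁ (filling x)

    u∈ : ∀ x → InC (face Υ) (ℕ.suc s) (u x)
    u∈ x = proj₁ (proj₂ (filling x))

    ∂u : ∀ x τ → R (p x) τ ≡ ∂ (u x) τ
    ∂u x = proj₂ (proj₂ (filling x))

    u-linear : Linear u
    u-linear σ a b {x} {y} {z} z≡ = ∂-injective (u∈ z)
      (InC-combination (u∈ x) (u∈ y) a b (λ _ → refl)) (λ τ → begin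
        ∂ (u z) τ                            ≡⟨ ∂u z τ ⟨
        R (p z) τ                            ≡⟨ restrict-linear (layer (face Υ) s) τ a b (λ ρ → p-linear ρ a b z≡) ⟩
        a * R (p x) τ + b * R (p y) τ        ≡⟨ cong₂ (λ k l → a * k + b * l) (∂u x τ) (∂u y τ) ⟩
        a * ∂ (u x) τ + b * ∂ (u y) τ        ≡⟨ ∂-linear τ a b {u x} {u y} (λ _ → refl) ⟨
        ∂ (λ ρ → a * u x ρ + b * u y ρ) τ    ∎) σ
      where open ≡-Reasoning

    u-section : ∀ x → InC (face Υ) (ℕ.suc s) x → ∀ σ → u (∂ x) σ ≡ x σ
    -- Since `∂ x` is already a cycle of `Υ`, both `p` and `R` fix it, so `u (∂ x)` and `x` fill the
    -- same cycle.
    u-section x x∈ = ∂-injective (u∈ (∂ x)) x∈ λ τ → begin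
      ∂ (u (∂ x)) τ      ≡⟨ ∂u (∂ x) τ ⟨
      R (p (∂ x)) τ      ≡⟨ form-cong (restrict-linear (layer (face Υ) s) τ) (p-fixes (∂ x) in-kernel) ⟩
      R (∂ x) τ          ≡⟨ R∂x≡∂x τ ⟩
      ∂ x τ              ∎
      where
      open ≡-Reasoning
      R∂x≡∂x : ∀ τ → R (∂ x) τ ≡ ∂ x τ
      R∂x≡∂x = restrict-layer (face Υ) s (∂-InC Υ x∈)
      in-kernel : ∀ τ → ∂ (R (∂ x)) τ ≡ 0ℤ
      in-kernel τ = trans (form-cong (∂-linear τ) R∂x≡∂x) (∂∂≡0 x τ)

  cochains-are-coboundaries : ∀ z → ∃ λ y → InC (face Υ) s y ×
    (∀ σ → T (face Υ σ) → ∣ σ ∣ ≡ ℕ.suc s → δ⁺ y σ ≡ z σ)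
  cochains-are-coboundaries =
    transpose-section Υ s (proj₁ ∂-section) (proj₁ (proj₂ ∂-section)) (proj₂ (proj₂ ∂-section))

-- The critical group

module CriticalGroup (Δ Υ : Complex n) (i : ℕ) (tree : IsSpanningTree (skel Δ i) i Υ)
         (acyclic : ℤC.Acyclic (face Υ) i) where

  open IsSpanningTree tree

  Υ⊆Δ : ∀ σ → T (face Υ σ) → T (face Δ σ)
  Υ⊆Δ σ υ = proj₁ (Equivalence.to T-∧ (subcomplex σ υ))

  Υ-dim : ∀ σ → T (face Υ σ) → ∣ σ ∣ ≤ ℕ.suc i
  Υ-dim σ υ = ℕP.≤ᵇ⇒≤ _ _ (proj₂ (Equivalence.to (T-∧ {face Δ σ}) (subcomplex σ υ)))

  Δᵢ₋₁⊆Υ : ∀ σ → ∣ σ ∣ ≡ i → T (face Δ σ) → T (face Υ σ)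
  Δᵢ₋₁⊆Υ σ refl k = same-skel σ ℕP.≤-refl (Equivalence.from T-∧ (k , ℕP.≤⇒≤ᵇ (ℕP.n≤1+n ∣ σ ∣)))

  Θᵢ : Subset n → Bool
  Θᵢ = Θ Δ Υ i

  Θ-intro : ∀ {σ} → T (face Δ σ) → ¬ T (face Υ σ) → ∣ σ ∣ ≡ ℕ.suc i → T (Θᵢ σ)
  Θ-intro {σ} k ¬υ card = Equivalence.from T-∧ (k , Equivalence.from T-∧ (T-not ¬υ , ℕP.≡⇒≡ᵇ _ _ card))
    where
    T-not : ∀ {b} → ¬ T b → T (not b)
    T-not {true} ¬t = ⊥-elim (¬t _)
    T-not {false} ¬t = _

  Θ-elim : ∀ {σ} → T (Θᵢ σ) → T (face Δ σ) × ¬ T (face Υ σ) × ∣ σ ∣ ≡ ℕ.suc i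
  Θ-elim {σ} θ with k , θ′ ← Equivalence.to (T-∧ {face Δ σ}) θ
    with ¬υ , card ← Equivalence.to (T-∧ {not (face Υ σ)}) θ′ = k , not-T ¬υ , ℕP.≡ᵇ⇒≡ _ _ card
    where
    not-T : ∀ {b} → T (not b) → ¬ T b
    not-T {false} _ ()

  Θ⊆Δ : ∀ {x} → InC Θᵢ (ℕ.suc i) x → InC (face Δ) (ℕ.suc i) x
  Θ⊆Δ = InC-mono (λ σ _ θ → proj₁ (Θ-elim {σ} θ))

  InC-Θ : ∀ {x} → InC (face Δ) (ℕ.suc i) x →
          (∀ σ → T (face Υ σ) → ∣ σ ∣ ≡ ℕ.suc i → x σ ≡ 0ℤ) → InC Θᵢ (ℕ.suc i) x
  InC-Θ x∈ x-Υ≡0 σ σ∉ with T? (face Υ σ) | ∣ σ ∣ ℕ.≟ ℕ.suc i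
  ... | _      | no ¬card = x∈ σ (¬card ∘ proj₂)
  ... | yes υ  | yes card = x-Υ≡0 σ υ card
  ... | no ¬υ  | yes card = x∈ σ λ (k , _) → σ∉ (Θ-intro k ¬υ card , card)

  InC-Υ : ∀ {x} → InC (face Δ) (ℕ.suc i) x → (∀ σ → T (Θᵢ σ) → x σ ≡ 0ℤ) → InC (face Υ) (ℕ.suc i) x
  InC-Υ x∈ x-Θ≡0 σ σ∉ with T? (Θᵢ σ)
  ... | yes θ = x-Θ≡0 σ θ
  ... | no ¬θ = x∈ σ λ (k , card) → ¬θ (Θ-intro k (λ υ → σ∉ (υ , card)) card)

  -- Each cycle is a boundary by `top-acyclic`, but `Υ` has no faces of size `i + 2`, so every such
  -- boundary is zero.
  Υ-no-cycles : ∀ x → IsCycle (face Υ) (ℕ.suc i) x → ∀ σ → x σ ≡ 0ℤ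
  Υ-no-cycles x cycle σ with y , y∈ , x≡∂y ← top-acyclic x cycle =
    trans (x≡∂y σ) (form-zero (∂-linear σ) λ τ → y∈ τ λ (υ , card) →
      ℕP.1+n≰n (subst (_≤ ℕ.suc i) card (Υ-dim τ υ)))

  δ-subtraction : ∀ {y z} → InC (face Υ) i y → InC (face Δ) (ℕ.suc i) z →
    (∀ σ → T (face Υ σ) → ∣ σ ∣ ≡ ℕ.suc i → δ⁺ y σ ≡ z σ) →
    InC Θᵢ (ℕ.suc i) (z ⊖ δ (face Δ) y)
  δ-subtraction {y} {z} y∈ z∈ δy≡z = InC-Θ (InC-⊖ z∈ (δ-InC (face Δ) (InC-mono (λ σ _ → Υ⊆Δ σ) y∈)))
    (λ σ υ card → i≡j⇒i-j≡0 (sym (trans (restrict-in (face Δ) (δ⁺ y) (Υ⊆Δ σ υ)) (δy≡z σ υ card))))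

  Lap-δ-subtraction : ∀ y z σ → Lap Δ z σ ≡ Lap Δ (z ⊖ δ (face Δ) y) σ
  Lap-δ-subtraction y z σ = sym (begin
      Lap Δ (z ⊖ δ (face Δ) y) σ              ≡⟨ form-sub (Lap-linear Δ σ) {z} {δ (face Δ) y} (λ _ → refl) ⟩
      Lap Δ z σ - Lap Δ (δ (face Δ) y) σ      ≡⟨ cong (λ p → Lap Δ z σ - p) (form-zero (∂-linear σ) (δδ≡0 Δ y)) ⟩
      Lap Δ z σ - 0ℤ                          ≡⟨ +-identityʳ (Lap Δ z σ) ⟩
      Lap Δ z σ                               ∎)
    where open ≡-Reasoning

  -- On the `i`-faces of `Υ` the chain `z` agrees with the coboundary of some `y`. Subtracting that
  -- coboundary moves `z` onto Θ and leaves its Laplacian unchanged, as two successive coboundaries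
  -- compose to zero.
  Lap-Θ : ∀ z → InC (face Δ) (ℕ.suc i) z →
          ∃ λ z′ → InC Θᵢ (ℕ.suc i) z′ × (∀ σ → Lap Δ z σ ≡ Lap Δ z′ σ)
  Lap-Θ z z∈ = subtract (cochains-are-coboundaries Υ i Υ-no-cycles acyclic z)
    where
    subtract : (∃ λ y → InC (face Υ) i y × (∀ σ → T (face Υ σ) → ∣ σ ∣ ≡ ℕ.suc i → δ⁺ y σ ≡ z σ)) → _
    subtract (y , y∈ , δy≡z) = z ⊖ δ (face Δ) y , δ-subtraction y∈ z∈ δy≡z , Lap-δ-subtraction y z

  -- With this choice `redLap Δ Υ i z` is definitionally `φ (Lap Δ z)`, so the two denominators can
  -- be compared directly.
  φ : Chain n → Chain n
  φ = restrict Θᵢ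

  φ-⊖ : ∀ x y σ → φ (x ⊖ y) σ ≡ (φ x ⊖ φ y) σ
  φ-⊖ x y σ = form-sub (restrict-linear Θᵢ σ) {x} {y} (λ _ → refl)

  φ-∈ : ∀ x → Q-num Δ Υ i (φ x)
  φ-∈ x σ σ∉ = restrict-out Θᵢ x λ θ → σ∉ (θ , proj₂ (proj₂ (Θ-elim {σ} θ)))

  Q-den-zero : ∀ {x} → (∀ σ → x σ ≡ 0ℤ) → Q-den Δ Υ i x
  Q-den-zero x≡0 = (λ _ → 0ℤ) , (λ _ _ → refl) , λ σ → trans (x≡0 σ)
    (sym (form-zero (restrict-linear Θᵢ σ) λ τ → form-zero (Lap-linear Δ τ) (λ _ → refl)))

  φ-well-defined : ∀ x y → K-den Δ i (x ⊖ y) → Q-den Δ Υ i (φ x ⊖ φ y)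
  φ-well-defined x y (z , z∈ , x-y≡Lz) = compare (Lap-Θ z z∈)
    where
    compare : (∃ λ z′ → InC Θᵢ (ℕ.suc i) z′ × (∀ σ → Lap Δ z σ ≡ Lap Δ z′ σ)) → Q-den Δ Υ i (φ x ⊖ φ y)
    compare (z′ , z′∈ , Lz≡Lz′) = z′ , z′∈ , λ σ → trans (sym (φ-⊖ x y σ))
      (form-cong {Y = λ w → φ w σ} (restrict-linear Θᵢ σ) {x ⊖ y} {Lap Δ z′} (λ τ → trans (x-y≡Lz τ) (Lz≡Lz′ τ)))

  -- The difference `w` of `x ⊖ y` and `Lap Δ z` vanishes on Θ, hence is supported on `Υ`. It is
  -- also a cycle, and `Υ` carries no nonzero cycle in this dimension.
  φ-injective : ∀ x y → K-num Δ i x → K-num Δ i y → Q-den Δ Υ i (φ x ⊖ φ y) → K-den Δ i (x ⊖ y)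
  φ-injective x y (x∈ , ∂x≡0) (y∈ , ∂y≡0) (z , z∈ , φx-φy≡) =
    z , Θ⊆Δ z∈ , λ σ → i-j≡0⇒i≡j _ _ (Υ-no-cycles w (w∈ , ∂w≡0) σ)
    where
    w : Chain n
    w = (x ⊖ y) ⊖ Lap Δ z

    w∈ : InC (face Υ) (ℕ.suc i) w
    w∈ = InC-Υ (InC-⊖ (InC-⊖ x∈ y∈) (Lap-InC Δ (Θ⊆Δ z∈))) λ σ θ → i≡j⇒i-j≡0 (begin
      (x ⊖ y) σ            ≡⟨ restrict-in Θᵢ (x ⊖ y) θ ⟨
      φ (x ⊖ y) σ          ≡⟨ φ-⊖ x y σ ⟩
      (φ x ⊖ φ y) σ        ≡⟨ φx-φy≡ σ ⟩
      φ (Lap Δ z) σ        ≡⟨ restrict-in Θᵢ (Lap Δ z) θ ⟩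
      Lap Δ z σ            ∎)
      where open ≡-Reasoning

    ∂w≡0 : ∀ τ → ∂ w τ ≡ 0ℤ
    ∂w≡0 τ = trans (form-sub (∂-linear τ) {x ⊖ y} {Lap Δ z} (λ _ → refl)) (cong₂ _-_
      (trans (form-sub (∂-linear τ) {x} {y} (λ _ → refl)) (cong₂ _-_ (∂x≡0 τ) (∂y≡0 τ)))
      (∂∂≡0 (δ (face Δ) z) τ))

  -- As `Υ` contains all faces of `Δ` of size `i`, the boundary of `w` is a cycle of `Υ` and bounds
  -- some `u` there. Then `w ⊖ u` is a cycle, and subtracting `u` does not affect the values on Θ.
  φ-surjective : ∀ w → Q-num Δ Υ i w → ∃ λ x → K-num Δ i x × (∀ σ → φ x σ ≡ w σ)
  φ-surjective w w∈ = correct (acyclic (∂ w) (InC-mono Δᵢ₋₁⊆Υ (∂-InC Δ (Θ⊆Δ w∈)) , ∂∂≡0 w))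
    where
    φ[w-u]≡w : ∀ u → InC (face Υ) (ℕ.suc i) u → ∀ σ → φ (w ⊖ u) σ ≡ w σ
    φ[w-u]≡w u u∈ σ with T? (Θᵢ σ)
    ... | no ¬θ = trans (restrict-out Θᵢ (w ⊖ u) ¬θ) (sym (w∈ σ (¬θ ∘ proj₁)))
    ... | yes θ = trans (restrict-in Θᵢ (w ⊖ u) θ) (trans
            (cong (λ p → w σ - p) (u∈ σ (proj₁ (proj₂ (Θ-elim {σ} θ)) ∘ proj₁)))
            (+-identityʳ (w σ)))

    correct : ℤC.IsBoundary (face Υ) i (∂ w) → ∃ λ x → K-num Δ i x × (∀ σ → φ x σ ≡ w σ)
    correct (u , u∈ , ∂w≡∂u) = w ⊖ u ,
      (InC-⊖ (Θ⊆Δ w∈) (InC-mono (λ σ _ → Υ⊆Δ σ) u∈) ,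
       λ τ → trans (form-sub (∂-linear τ) {w} {u} (λ _ → refl)) (i≡j⇒i-j≡0 (∂w≡∂u τ))) ,
      φ[w-u]≡w u u∈

theorem3p4 : ∀ {n} (Δ : Complex n) (d i : ℕ) →
    IsPure Δ d →
    (∀ s → s ≤ d → ℚC.Acyclic (face Δ) s) →
    i < d →
    (Υ : Complex n) → IsSpanningTree (skel Δ i) i Υ →
    ℤC.Acyclic (face Υ) i →
    SubquotientIso (K-num Δ i) (K-den Δ i) (Q-num Δ Υ i) (Q-den Δ Υ i)
theorem3p4 Δ d i _ _ _ Υ tree acyclic = record
  { φ = φ
  ; φ-P = λ x _ → φ-∈ x
  ; φ-wd = λ x y _ _ → φ-well-defined x y
  ; φ-hom = λ x y _ _ → Q-den-zero λ σ → i≡j⇒i-j≡0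
      (form-add (restrict-linear Θᵢ σ) {x} {y} (λ _ → refl))
  ; φ-inj = φ-injective
  ; φ-surj = λ w w∈ → let x , x∈ , φx≡w = φ-surjective w w∈ in
      x , x∈ , Q-den-zero (λ σ → i≡j⇒i-j≡0 (φx≡w σ))
  }
  where open CriticalGroup Δ Υ i tree acyclic
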